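{- Let $G$ be a finite simple graph that is $\{2K_2, K_2+P_4\}$-free and satisfies $\omega(G)\geq 4$. Then $\chi(G)\leq \omega(G)+2$.
   Context: $\chi(G)$ is the chromatic number and $\omega(G)$ the clique number of $G$. $2K_2$ is the disjoint union of two edges; $P_4$ is the path on four vertices. For graphs $G_1,G_2$, the join $G_1+G_2$ is their disjoint union together with all edges between $V(G_1)$ and $V(G_2)$; so $K_2+P_4$ is the graph on six vertices consisting of an edge and a $P_4$ with every vertex of the edge adjacent to every vertex of the $P_4$. A graph is $\mathcal{F}$-free if it has no induced subgraph isomorphic to a member of $\mathcal{F}$. -}

module Defs where

open import Data.Nat using (ℕ; _≤_; _+_)
open import Data.Fin using (Fin; zero; suc)
open import Data.Bool using (Bool; true; false)
open import Data.Product using (Σ; _×_; ∃)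
open import Relation.Binary.PropositionalEquality using (_≡_; _≢_)
open import Relation.Nullary using (¬_)
open import Function.Definitions using (Injective)

record Graph (n : ℕ) : Set where
  field
    adj   : Fin n → Fin n → Bool
    sym   : ∀ u v → adj u v ≡ adj v u
    irrefl : ∀ v → adj v v ≡ false
open Graph public

record InducedEmbedding {m n : ℕ} (H : Graph m) (G : Graph n) : Set where
  field
    f     : Fin m → Fin n
    inj   : Injective _≡_ _≡_ f
    pres  : ∀ i j → adj G (f i) (f j) ≡ adj H i j
open InducedEmbedding public

_⊑_ : {m n : ℕ} → Graph m → Graph n → Set
H ⊑ G = InducedEmbedding H G

_Free_ : {m n : ℕ} → Graph n → Graph m → Set
G Free H = ¬ (H ⊑ G)

adj2K2 : Fin 4 → Fin 4 → Bool
adj2K2 zero (suc zero) = true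
adj2K2 (suc zero) zero = true
adj2K2 (suc (suc zero)) (suc (suc (suc zero))) = true
adj2K2 (suc (suc (suc zero))) (suc (suc zero)) = true
adj2K2 _ _ = false

twoK2 : Graph 4
twoK2 = record { adj = adj2K2 ; sym = s ; irrefl = r }
  where
  s : ∀ u v → adj2K2 u v ≡ adj2K2 v u
  s zero zero = _≡_.refl
  s zero (suc zero) = _≡_.refl
  s zero (suc (suc zero)) = _≡_.refl
  s zero (suc (suc (suc zero))) = _≡_.refl
  s (suc zero) zero = _≡_.refl
  s (suc zero) (suc zero) = _≡_.refl
  s (suc zero) (suc (suc zero)) = _≡_.refl
  s (suc zero) (suc (suc (suc zero))) = _≡_.refl
  s (suc (suc zero)) zero = _≡_.refl
  s (suc (suc zero)) (suc zero) = _≡_.refl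
  s (suc (suc zero)) (suc (suc zero)) = _≡_.refl
  s (suc (suc zero)) (suc (suc (suc zero))) = _≡_.refl
  s (suc (suc (suc zero))) zero = _≡_.refl
  s (suc (suc (suc zero))) (suc zero) = _≡_.refl
  s (suc (suc (suc zero))) (suc (suc zero)) = _≡_.refl
  s (suc (suc (suc zero))) (suc (suc (suc zero))) = _≡_.refl
  r : ∀ v → adj2K2 v v ≡ false
  r zero = _≡_.refl
  r (suc zero) = _≡_.refl
  r (suc (suc zero)) = _≡_.refl
  r (suc (suc (suc zero))) = _≡_.refl

-- K₂ + P₄ on Fin 6: vertices 0,1 form the K₂; vertices 2-3-4-5 form the P₄
-- (edges 23, 34, 45); and 0,1 are adjacent to every one of 2,3,4,5.
-- Given as an explicit edge list on vertex indices.
isEdgeK2P4 : Fin 6 → Fin 6 → Bool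
isEdgeK2P4 zero (suc zero) = true
isEdgeK2P4 zero (suc (suc _)) = true
isEdgeK2P4 (suc zero) (suc (suc _)) = true
isEdgeK2P4 (suc (suc zero)) (suc (suc (suc zero))) = true
isEdgeK2P4 (suc (suc (suc zero))) (suc (suc (suc (suc zero)))) = true
isEdgeK2P4 (suc (suc (suc (suc zero)))) (suc (suc (suc (suc (suc zero))))) = true
isEdgeK2P4 _ _ = false

open import Data.Bool using (_∨_)

adjK2P4 : Fin 6 → Fin 6 → Bool
adjK2P4 u v = isEdgeK2P4 u v ∨ isEdgeK2P4 v u

open import Data.Bool.Properties using (∨-comm)

K2+P4 : Graph 6
K2+P4 = record { adj = adjK2P4 ; sym = λ u v → ∨-comm (isEdgeK2P4 u v) (isEdgeK2P4 v u) ; irrefl = r }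
  where
  r : ∀ v → adjK2P4 v v ≡ false
  r zero = _≡_.refl
  r (suc zero) = _≡_.refl
  r (suc (suc zero)) = _≡_.refl
  r (suc (suc (suc zero))) = _≡_.refl
  r (suc (suc (suc (suc zero)))) = _≡_.refl
  r (suc (suc (suc (suc (suc zero))))) = _≡_.refl

HasClique : {n : ℕ} → Graph n → ℕ → Set
HasClique {n} G k =
  Σ (Fin k → Fin n) λ c → Injective _≡_ _≡_ c × (∀ i j → i ≢ j → adj G (c i) (c j) ≡ true)

CliqueNumber : {n : ℕ} → Graph n → ℕ → Set
CliqueNumber G w = HasClique G w × ¬ HasClique G (w + 1)

Colorable : {n : ℕ} → Graph n → ℕ → Set
Colorable {n} G k =
  Σ (Fin n → Fin k) λ col → ∀ u v → adj G u v ≡ true → col u ≢ col v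

-- χ(G) ≤ k  ⇔  G has a proper k-colouring (χ(G) is the least such k).

{-# OPTIONS --safe #-}
-- Fix a maximum clique c and let Ā(x) be the set of indices i such that x is not
-- adjacent to c i; it is nonempty by maximality (and Ā(c i) = {i}).  Let u, v be
-- adjacent.  If Ā(u) and Ā(v) share two indices, then these and u, v induce a 2K₂.
-- If they share exactly i and some q lies in Ā(v) only, then c i – c q – u – v is an
-- induced P₄, so at most one vertex of the clique is adjacent to both u and v; and
-- Ā(u) = Ā(v) = {i} would allow replacing c i by u and v.
-- So {x : i ∈ Ā(x), k, l ∉ Ā(x)} is independent for k ≠ l, and so is
-- {x : i, j ∈ Ā(x)} for i ≠ j.  With the first four indices 0, 1, 2, 3 arranged in
-- a cycle, two new colours serve the x for which Ā(x) contains one of the diagonals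
-- {0,2}, {1,3}.  Otherwise Ā(x) meets the cycle in ∅, {i} or {i, i+1}, and x gets
-- colour i, respectively (for ∅) any element of Ā(x).
module Submission where

open import Defs
open import Data.Nat using (ℕ; zero; suc; _≤_; _+_; s≤s; z≤n)
open import Data.Nat.Properties using (+-comm)
open import Data.Bool using (true; false)
import Data.Bool.Properties as Bool
open import Data.Fin using (Fin; zero; suc; splitAt; join; _≟_)
open import Data.Fin.Patterns
open import Data.Fin.Properties using (all?; any?; ¬∀⟶∃¬; splitAt-join)
open import Data.Vec using ([]; _∷_; lookup)
open import Data.Product using (∃; _×_; _,_; proj₁; proj₂)
open import Data.Sum using (_⊎_; inj₁; inj₂)
open import Data.Unit using (⊤; tt)
open import Data.Empty using (⊥; ⊥-elim)
open import Function.Definitions using (Injective)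
open import Relation.Nullary using (¬_; yes; no; contradiction; ¬?; _⊎-dec_)
open import Relation.Nullary.Decidable using (Dec; toWitness)
open import Relation.Binary.PropositionalEquality using (_≡_; _≢_; refl; trans; cong; subst)
import Relation.Binary.PropositionalEquality as ≡

true≢false : ∀ {b} → b ≡ true → b ≡ false → ⊥
true≢false refl ()

-- Row `i` holds only the columns after `i`, renumbered from zero, so a concrete embedding treats
-- each pair once; reflexivity and symmetry supply the rest.
UpperTri : (m : ℕ) → (Fin m → Fin m → Set) → Set
UpperTri zero    P = ⊤
UpperTri (suc m) P = (∀ j → P zero (suc j)) × UpperTri m (λ i j → P (suc i) (suc j))

upperTri⇒all : ∀ {m} (P : Fin m → Fin m → Set) → (∀ i → P i i) →
  (∀ i j → P i j → P j i) → UpperTri m P → ∀ i j → P i j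
upperTri⇒all P r s (row , rest) zero    zero    = r zero
upperTri⇒all P r s (row , rest) zero    (suc j) = row j
upperTri⇒all P r s (row , rest) (suc i) zero    = s zero (suc i) (row i)
upperTri⇒all P r s (row , rest) (suc i) (suc j) =
  upperTri⇒all (λ i j → P (suc i) (suc j)) (λ i → r (suc i)) (λ i j → s (suc i) (suc j)) rest i j

-- In a graph without twins, preservation of (non-)adjacency forces injectivity.
TwinFree : ∀ {m} → Graph m → Set
TwinFree H = ∀ i j → i ≡ j ⊎ ∃ λ k → adj H i k ≢ adj H j k

twinFree? : ∀ {m} (H : Graph m) → Dec (TwinFree H)
twinFree? H = all? λ i → all? λ j → (i ≟ j) ⊎-dec any? λ k → ¬? (adj H i k Bool.≟ adj H j k)

embedding : ∀ {m n} {H : Graph m} {G : Graph n} → TwinFree H → (f : Fin m → Fin n) →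
  UpperTri m (λ i j → adj G (f i) (f j) ≡ adj H i j) → H ⊑ G
embedding {H = H} {G} twinFree f tri = record { f = f ; inj = f-inj ; pres = f-pres }
  where
  f-pres : ∀ i j → adj G (f i) (f j) ≡ adj H i j
  f-pres = upperTri⇒all _
    (λ i → trans (irrefl G (f i)) (≡.sym (irrefl H i)))
    (λ i j e → trans (sym G (f j) (f i)) (trans e (sym H i j))) tri

  f-inj : Injective _≡_ _≡_ f
  f-inj {i} {j} fi≡fj with twinFree i j
  ... | inj₁ i≡j      = i≡j
  ... | inj₂ (k , ne) = contradiction
    (trans (≡.sym (f-pres i k)) (trans (cong (λ v → adj G v (f k)) fi≡fj) (f-pres j k))) ne

module _ {n : ℕ} (G : Graph n) where

  infix 4 _~_ _≁_

  _~_ _≁_ : Fin n → Fin n → Set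
  u ~ v = adj G u v ≡ true
  u ≁ v = adj G u v ≡ false

  adj-sym : ∀ {u v b} → adj G u v ≡ b → adj G v u ≡ b
  adj-sym {u} {v} = trans (sym G v u)

  IsClique : ∀ {m} → (Fin m → Fin n) → Set
  IsClique c = ∀ i j → i ≢ j → c i ~ c j

  hasClique : ∀ {m} (c : Fin m → Fin n) → IsClique c → HasClique G m
  hasClique c clq = c , c-inj , clq
    where
    c-inj : Injective _≡_ _≡_ c
    c-inj {i} {j} ci≡cj with i ≟ j
    ... | yes i≡j = i≡j
    ... | no i≢j  = ⊥-elim (true≢false (clq i j i≢j)
      (subst (λ v → c i ≁ v) ci≡cj (irrefl G (c i))))

  extend : ∀ {m} (c : Fin m → Fin n) → IsClique c → ∀ x → (∀ i → x ~ c i) → HasClique G (m + 1)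
  extend {m} c clq x x~c = subst (HasClique G) (+-comm 1 m) (hasClique c′ clq′)
    where
    c′ : Fin (suc m) → Fin n
    c′ zero    = x
    c′ (suc i) = c i

    clq′ : IsClique c′
    clq′ zero    zero    0≢0 = contradiction refl 0≢0
    clq′ zero    (suc j) _   = x~c j
    clq′ (suc i) zero    _   = adj-sym (x~c i)
    clq′ (suc i) (suc j) i≢j = clq i j (λ e → i≢j (cong suc e))

  -- Serves the case where `c i` is the only clique vertex missed by `u` and by `v`: `u` takes the
  -- place of `c i`, then `v` is added.
  replace-extend : ∀ {m} (c : Fin m → Fin n) → IsClique c → ∀ i u v → u ~ v →
    (∀ j → j ≢ i → u ~ c j) → (∀ j → j ≢ i → v ~ c j) → HasClique G (m + 1)
  replace-extend {m} c clq i u v u~v u~c v~c = extend c′ clq′ v v~c′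
    where
    c′ : Fin m → Fin n
    c′ j with j ≟ i
    ... | yes _ = u
    ... | no  _ = c j

    clq′ : IsClique c′
    clq′ j k j≢k with j ≟ i | k ≟ i
    ... | yes refl | yes refl = contradiction refl j≢k
    ... | yes _    | no k≢i   = u~c k k≢i
    ... | no j≢i   | yes _    = adj-sym (u~c j j≢i)
    ... | no _     | no _     = clq j k j≢k

    v~c′ : ∀ j → v ~ c′ j
    v~c′ j with j ≟ i
    ... | yes _  = adj-sym u~v
    ... | no j≢i = v~c j j≢i

  twoK2-embedding : ∀ {p q u v} → p ~ q → u ~ v → p ≁ u → p ≁ v → q ≁ u → q ≁ v → twoK2 ⊑ G
  twoK2-embedding {p} {q} {u} {v} pq uv pu pv qu qv =
    -- Twin-freeness of this fixed graph is settled by evaluating `twinFree?`; injectivity then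
    -- follows without comparing the vertices.
    embedding (toWitness {a? = twinFree? twoK2} tt) (lookup (p ∷ q ∷ u ∷ v ∷ []))
      ( (λ { 0F → pq ; 1F → pu ; 2F → pv })
      , (λ { 0F → qu ; 1F → qv })
      , (λ { 0F → uv })
      , (λ ()) , tt )

  K2+P4-embedding : ∀ {k l p q u v} → k ~ l →
    k ~ p → k ~ q → k ~ u → k ~ v → l ~ p → l ~ q → l ~ u → l ~ v →
    p ~ q → q ~ u → u ~ v → p ≁ u → p ≁ v → q ≁ v → K2+P4 ⊑ G
  K2+P4-embedding {k} {l} {p} {q} {u} {v} kl kp kq ku kv lp lq lu lv pq qu uv pu pv qv =
    embedding (toWitness {a? = twinFree? K2+P4} tt) (lookup (k ∷ l ∷ p ∷ q ∷ u ∷ v ∷ []))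
      ( (λ { 0F → kl ; 1F → kp ; 2F → kq ; 3F → ku ; 4F → kv })
      , (λ { 0F → lp ; 1F → lq ; 2F → lu ; 3F → lv })
      , (λ { 0F → pq ; 1F → pu ; 2F → pv })
      , (λ { 0F → qu ; 1F → qv })
      , (λ { 0F → uv })
      , (λ ()) , tt )

  module MaximumClique {m} (c : Fin m → Fin n) (clq : IsClique c)
    (maximum : ¬ HasClique G (m + 1)) (2K2-free : G Free twoK2) (K2P4-free : G Free K2+P4) where

    distinct : ∀ {x i j} → x ~ c i → x ≁ c j → i ≢ j
    distinct x~ci x≁cj refl = true≢false x~ci x≁cj

    nonneighbour : ∀ x → ∃ λ i → x ≁ c i
    nonneighbour x with all? (λ i → adj G x (c i) Bool.≟ true)
    ... | yes x~c = contradiction (extend c clq x x~c) maximum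
    ... | no ¬x~c with ¬∀⟶∃¬ m _ (λ i → adj G x (c i) Bool.≟ true) ¬x~c
    ...   | i , x≁ci = i , Bool.¬-not x≁ci

    two-nonneighbours-independent : ∀ {i j} → i ≢ j → ∀ {u v} →
      u ≁ c i → u ≁ c j → v ≁ c i → v ≁ c j → ¬ u ~ v
    two-nonneighbours-independent {i} {j} i≢j ui uj vi vj uv = 2K2-free
      (twoK2-embedding (clq i j i≢j) uv (adj-sym ui) (adj-sym vi) (adj-sym uj) (adj-sym vj))

    no-private-nonneighbour : ∀ {k l} → k ≢ l → ∀ {i q u v} → u ~ v →
      u ≁ c i → v ≁ c i → u ~ c k → u ~ c l → v ~ c k → v ~ c l → u ~ c q → v ≁ c q → ⊥
    no-private-nonneighbour {k} {l} k≢l {i} {q} uv ui vi uk ul vk vl uq vq = K2P4-free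
      (K2+P4-embedding (clq k l k≢l)
        -- Each inequality of indices is witnessed by `u` or `v` seeing one of the two clique
        -- vertices and missing the other.
        (clq k i (distinct uk ui)) (clq k q (distinct vk vq)) (adj-sym uk) (adj-sym vk)
        (clq l i (distinct ul ui)) (clq l q (distinct vl vq)) (adj-sym ul) (adj-sym vl)
        (clq i q (λ e → distinct uq ui (≡.sym e))) (adj-sym uq) uv
        (adj-sym ui) (adj-sym vi) (adj-sym vq))

    -- At an index `j` other than `i`, a miss by just one of `u`, `v` gives the induced K₂ + P₄, and
    -- a miss by both gives a 2K₂. So both see all of the clique outside `c i`, and trading `c i`
    -- for the two enlarges it.
    one-nonneighbour-independent : ∀ {k l} → k ≢ l → ∀ {i u v} →
      u ≁ c i → u ~ c k → u ~ c l → v ≁ c i → v ~ c k → v ~ c l → ¬ u ~ v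
    one-nonneighbour-independent k≢l {i} {u} {v} ui uk ul vi vk vl uv =
      maximum (replace-extend c clq i u v uv
        (λ j j≢i → proj₁ (both j j≢i)) (λ j j≢i → proj₂ (both j j≢i)))
      where
      both : ∀ j → j ≢ i → u ~ c j × v ~ c j
      both j j≢i with adj G u (c j) in uj | adj G v (c j) in vj
      ... | true  | true  = refl , refl
      ... | true  | false = ⊥-elim (no-private-nonneighbour k≢l uv ui vi uk ul vk vl uj vj)
      ... | false | true  = ⊥-elim (no-private-nonneighbour k≢l (adj-sym uv) vi ui vk vl uk ul vj uj)
      ... | false | false = ⊥-elim (two-nonneighbours-independent j≢i uj ui vj vi uv)

  module Colouring {r} (c : Fin (4 + r) → Fin n) (clq : IsClique c)
    (maximum : ¬ HasClique G (4 + r + 1)) (2K2-free : G Free twoK2) (K2P4-free : G Free K2+P4) where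

    open MaximumClique c clq maximum 2K2-free K2P4-free

    -- On the cycle 0, 1, 2, 3 these are i + 2 and i + 3.
    avoided : Fin (4 + r) → Fin (4 + r) × Fin (4 + r)
    avoided 0F = 2F , 3F
    avoided 1F = 3F , 0F
    avoided 2F = 0F , 1F
    avoided 3F = 1F , 2F
    avoided (suc (suc (suc (suc _)))) = 0F , 1F

    avoided-distinct : ∀ i → proj₁ (avoided i) ≢ proj₂ (avoided i)
    avoided-distinct 0F ()
    avoided-distinct 1F ()
    avoided-distinct 2F ()
    avoided-distinct 3F ()
    avoided-distinct (suc (suc (suc (suc _)))) ()

    -- The tags are the colours: one per clique index and one per diagonal. Classes may overlap; it
    -- is enough that each is independent and that together they cover the graph.
    Class : Fin (4 + r) ⊎ Fin 2 → Fin n → Set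
    Class (inj₁ i)  x = x ≁ c i × x ~ c (proj₁ (avoided i)) × x ~ c (proj₂ (avoided i))
    Class (inj₂ 0F) x = x ≁ c 0F × x ≁ c 2F
    Class (inj₂ 1F) x = x ≁ c 1F × x ≁ c 3F

    class-independent : ∀ s {u v} → Class s u → Class s v → ¬ u ~ v
    class-independent (inj₁ i) (ui , uk , ul) (vi , vk , vl) =
      one-nonneighbour-independent (avoided-distinct i) ui uk ul vi vk vl
    class-independent (inj₂ 0F) (u0 , u2) (v0 , v2) =
      two-nonneighbours-independent (λ ()) u0 u2 v0 v2
    class-independent (inj₂ 1F) (u1 , u3) (v1 , v3) =
      two-nonneighbours-independent (λ ()) u1 u3 v1 v3

    classify : ∀ x → ∃ λ s → Class s x
    classify x with adj G x (c 0F) in e0 | adj G x (c 1F) in e1 | adj G x (c 2F) in e2 | adj G x (c 3F) in e3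
    ... | false | _     | false | _     = inj₂ 0F , e0 , e2
    ... | _     | false | _     | false = inj₂ 1F , e1 , e3
    -- With the diagonals gone, the wildcard in each of the next four rows is the cyclic successor
    -- of `i`, which may or may not be missed.
    ... | false | _     | true  | true  = inj₁ 0F , e0 , e2 , e3
    ... | true  | false | _     | true  = inj₁ 1F , e1 , e3 , e0
    ... | true  | true  | false | _     = inj₁ 2F , e2 , e0 , e1
    ... | _     | true  | true  | false = inj₁ 3F , e3 , e1 , e2
    ... | true  | true  | true  | true  with nonneighbour x
    ...   | 0F , x≁ = ⊥-elim (true≢false e0 x≁)
    ...   | 1F , x≁ = ⊥-elim (true≢false e1 x≁)
    ...   | 2F , x≁ = ⊥-elim (true≢false e2 x≁)
    ...   | 3F , x≁ = ⊥-elim (true≢false e3 x≁)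
    -- Here `x` sees all four cycle vertices, so any two of them could be the avoided pair.
    ...   | i@(suc (suc (suc (suc _)))) , x≁ = inj₁ i , x≁ , e0 , e1

    colour : Fin n → Fin (4 + r + 2)
    colour x = join (4 + r) 2 (proj₁ (classify x))

    colour-reflects-class : ∀ {u v} → colour u ≡ colour v → proj₁ (classify u) ≡ proj₁ (classify v)
    colour-reflects-class {u} {v} e =
      trans (≡.sym (splitAt-join (4 + r) 2 (proj₁ (classify u))))
        (trans (cong (splitAt (4 + r)) e) (splitAt-join (4 + r) 2 (proj₁ (classify v))))

    colourable : Colorable G (4 + r + 2)
    colourable = colour , λ u v u~v e →
      class-independent (proj₁ (classify v))
        (subst (λ s → Class s u) (colour-reflects-class e) (proj₂ (classify u)))
        (proj₂ (classify v)) u~v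

theorem2p6 : (n : ℕ) (G : Graph n) (ω : ℕ) →
    G Free twoK2 → G Free K2+P4 →
    CliqueNumber G ω → 4 ≤ ω →
    Colorable G (ω + 2)
-- Matching on `4 ≤ ω` turns `ω` into `4 + r`, which exposes the four indices of the cycle.
theorem2p6 n G _ 2K2-free K2P4-free ((c , _ , clq) , maximum) (s≤s (s≤s (s≤s (s≤s z≤n)))) =
  Colouring.colourable G c clq maximum 2K2-free K2P4-free
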